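{- Let $m\ge1$, let $B$ and $B'$ be two $m$-level rook equivalent Ferrers boards, and let $N$ be large enough that $B$ and $B'$ both fit inside $\mathrm{Sq}_{N,m}$. Then for any integer $0\le k\le N$, $h^{(m)}_{k,N}(B)=h^{(m)}_{k,N}(B')$.
   Context: Fix an integer $m\ge 1$. A Ferrers board with columns of heights $0\le b_1\le\dots\le b_n$ consists of bottom-justified columns of these heights, left to right. Level $p$ ($p\ge1$) consists of rows $(p-1)m+1,\dots,pm$, counted from the bottom. An $m$-level rook placement of $k$ rooks on a board is a set of $k$ of its cells, no two in the same column or the same level; $r_{k,m}(B)$ is the number of these on $B$; $B,B'$ are $m$-level rook equivalent if $r_{k,m}(B)=r_{k,m}(B')$ for all $k\ge0$. $\mathrm{Sq}_{N,m}$ is the rectangular board with $N$ columns and $mN$ rows. $B$ fits inside it if, on aligning the lower right cells, $B\subseteq \mathrm{Sq}_{N,m}$; $B$ is then so placed. For $\omega=(\alpha^{s_1},\dots,\alpha^{s_N};\sigma)\in C_m\wr S_N$ ($\alpha$ a generator of the cyclic group $C_m$, $1\le s_i\le m$, $\sigma\in S_N$), $R(\omega)$ is the placement on $\mathrm{Sq}_{N,m}$ with, for each $i$, a rook in column $i$, in level $N+1-\sigma(i)$, in the $s_i$-th cell from the bottom of that level. The $k$th hit set is $H^{(m)}_{k,N}(B)=\{R(\omega)\mid \omega\in C_m\wr S_N,\ \#(R(\omega)\cap B)=k\}$ and the $k$th hit number is $h^{(m)}_{k,N}(B)=\#H^{(m)}_{k,N}(B)$. -}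

module Defs where

open import Data.Nat.Base using (ℕ; zero; suc; _+_; _*_; _/_; _≤_; NonZero)
open import Data.Nat.Properties using (_≟_; ≤-refl)
open import Data.Fin.Base as Fin using (Fin; toℕ; opposite; punchIn; punchOut)
import Data.Fin.Properties as Fin
open import Data.Fin.Permutation using (Permutation′; _⟨$⟩ʳ_; _≈_; id; insert; remove; insert-remove)
open import Data.List.Base using (List; []; _∷_; _++_; map; concatMap; cartesianProductWith; allFin; upTo; filter; length; deduplicate)
open import Data.List.Membership.Propositional.Properties using (∈-allFin)
open import Data.List.Relation.Binary.Subset.Propositional using (_⊆_)
open import Data.List.Relation.Unary.AllPairs using (AllPairs; allPairs?)
open import Data.List.Relation.Unary.Any as Any using (Any; here)
open import Data.List.Relation.Unary.Any.Properties using (cartesianProductWith⁺)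
open import Data.Product.Base using (_×_; _,_; proj₁; proj₂)
open import Data.Product.Properties using (≡-dec)
open import Data.Vec.Base using (Vec; []; _∷_; lookup)
open import Relation.Binary.Definitions using (Decidable; DecidableEquality)
open import Relation.Binary.PropositionalEquality using (_≡_; _≢_; refl; sym; trans; cong)
open import Relation.Nullary.Decidable using (yes; no; ¬?; _×-dec_)

-- A cell is (column , row), both 0-based. Columns are counted from the RIGHT
-- and rows from the bottom, so that aligning the lower right cells of two
-- boards is the identity on coordinates.
Cell : Set
Cell = ℕ × ℕ

column row : Cell → ℕ
column = proj₁
row    = proj₂

_≟ᶜ_ : DecidableEquality Cell
_≟ᶜ_ = ≡-dec _≟_ _≟_

open import Data.List.Membership.DecPropositional _≟ᶜ_ using (_∈?_)
open import Data.List.Relation.Binary.Subset.DecPropositional _≟ᶜ_ using (_⊆?_)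

-- The columns of a board are indexed from left to right.
record FerrersBoard : Set where
  field
    width  : ℕ
    height : Fin width → ℕ
    mono   : ∀ {i j} → i Fin.≤ j → height i ≤ height j

open FerrersBoard public

-- Duplicate-free.
cells : FerrersBoard → List Cell
cells B = concatMap (λ i → map (toℕ (opposite i) ,_) (upTo (height B i))) (allFin (width B))

Sq : (N m : ℕ) → FerrersBoard
Sq N m = record { width = N ; height = λ _ → m * N ; mono = λ _ → ≤-refl }

-- Inclusion of sets of cells: columns of height 0 contribute no cell.
_FitsIn_ : FerrersBoard → FerrersBoard → Set
B FitsIn S = cells B ⊆ cells S

-- Level p (p ≥ 1) is the set of 0-based rows r with r / m ≡ p - 1.
level : (m : ℕ) .{{_ : NonZero m}} → Cell → ℕ
level m c = suc (row c / m)

NonAttacking : (m : ℕ) .{{_ : NonZero m}} → Cell → Cell → Set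
NonAttacking m c d = column c ≢ column d × level m c ≢ level m d

nonAttacking? : (m : ℕ) .{{_ : NonZero m}} → Decidable (NonAttacking m)
nonAttacking? m c d = ¬? (column c ≟ column d) ×-dec ¬? (level m c ≟ level m d)

-- The sublists of length k; for a duplicate-free list these list each
-- k-element subset exactly once.
choose : ∀ {A : Set} → ℕ → List A → List (List A)
choose zero    xs       = [] ∷ []
choose (suc k) []       = []
choose (suc k) (x ∷ xs) = map (x ∷_) (choose k xs) ++ choose (suc k) xs

rookPlacements : (k m : ℕ) .{{_ : NonZero m}} → FerrersBoard → List (List Cell)
rookPlacements k m B = filter (allPairs? (nonAttacking? m)) (choose k (cells B))

rookNumber : (k m : ℕ) .{{_ : NonZero m}} → FerrersBoard → ℕ
rookNumber k m B = length (rookPlacements k m B)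

RookEquivalent : (m : ℕ) .{{_ : NonZero m}} → FerrersBoard → FerrersBoard → Set
RookEquivalent m B B′ = ∀ k → rookNumber k m B ≡ rookNumber k m B′

-- (α^s₁ , … , α^s_N ; σ) is encoded by the exponents sᵢ - 1 : Fin m
-- (where 1 ≤ sᵢ ≤ m) and by σ acting on 0-based indices.
record C_≀S_ (m N : ℕ) : Set where
  constructor _⨾_
  field
    exponents : Vec (Fin m) N
    perm      : Permutation′ N

open C_≀S_ public

allVecs : ∀ {A : Set} → List A → (n : ℕ) → List (Vec A n)
allVecs as zero    = [] ∷ []
allVecs as (suc n) = cartesianProductWith _∷_ as (allVecs as n)

-- A permutation of suc n points is determined by the image j of the first
-- point and the permutation of n points left after deleting both.
allPermutations : (n : ℕ) → List (Permutation′ n)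
allPermutations zero    = id ∷ []
allPermutations (suc n) = cartesianProductWith (insert Fin.zero) (allFin (suc n)) (allPermutations n)

allPermutations-complete : ∀ {n} (π : Permutation′ n) → Any (π ≈_) (allPermutations n)
allPermutations-complete {zero}  π = here λ ()
allPermutations-complete {suc n} π =
  cartesianProductWith⁺ (insert Fin.zero)
    (λ { {_} {ρ} refl p i → trans (sym (insert-remove Fin.zero π i)) (insert-cong (remove Fin.zero π) ρ p i) })
    (∈-allFin (π ⟨$⟩ʳ Fin.zero)) (allPermutations-complete (remove Fin.zero π))
  where
  insert-cong : ∀ {j} (ρ τ : Permutation′ n) → ρ ≈ τ → insert Fin.zero j ρ ≈ insert Fin.zero j τ
  insert-cong {j} ρ τ p i with Fin.zero Fin.≟ i
  ... | yes _ = refl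
  ... | no ¬q = cong (punchIn j) (p (punchOut ¬q))

wreathElements : (m N : ℕ) → List (C m ≀S N)
wreathElements m N = cartesianProductWith _⨾_ (allVecs (allFin m) N) (allPermutations N)

-- Column i from the left is opposite i from the right. With 1-based σ(i), the
-- level N + 1 - σ(i) starts at 0-based row m (N - σ(i)); as a 0-based index,
-- N - σ(i) is the opposite of σ(i).
R : ∀ {m N} → C m ≀S N → List Cell
R {m} {N} ω = map (λ i → toℕ (opposite i) , m * toℕ (opposite (perm ω ⟨$⟩ʳ i)) + toℕ (lookup (exponents ω) i)) (allFin N)

#_∩_ : List Cell → FerrersBoard → ℕ
# P ∩ B = length (filter (_∈? cells B) P)

-- Equality of lists of cells as sets.
_≐_ : List Cell → List Cell → Set
P ≐ Q = P ⊆ Q × Q ⊆ P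

_≐?_ : Decidable _≐_
P ≐? Q = (P ⊆? Q) ×-dec (Q ⊆? P)

hitSet : (k N m : ℕ) → FerrersBoard → List (List Cell)
hitSet k N m B = deduplicate _≐?_ (filter (λ P → (# P ∩ B) ≟ k) (map R (wreathElements m N)))

hitNumber : (k N m : ℕ) → FerrersBoard → ℕ
hitNumber k N m B = length (hitSet k N m B)

{-# OPTIONS --safe #-}

-- Counting in two ways the pairs of a full placement R(ω) and j of its rooks
-- lying on B gives
--   ∑_ω C(#(R(ω) ∩ B), j) = r_{j,m}(B) · m^(N-j) · (N-j)!,
-- since each placement of j rooks on B extends to m^(N-j) (N-j)! full ones.
-- So the rook numbers determine all binomial moments of the distribution of
-- #(R(ω) ∩ B), and these determine the distribution, i.e. the hit numbers.
-- The double count is carried out by expanding along the first column: rooks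
-- on the remaining columns see the remaining list of levels.

module Submission where

open import Defs
open import Data.Bool.Base using (true; false; _∧_; if_then_else_)
open import Data.Fin.Base using (Fin; zero; suc; toℕ; fromℕ<; opposite; punchIn)
open import Data.Fin.Permutation using (Permutation′; _⟨$⟩ʳ_; _≈_; insert; insert-punchIn)
import Data.Fin.Properties as Fin
open import Data.List.Base using (List; []; _∷_; _++_; map; filter; length; allFin; tabulate; upTo; deduplicate; cartesianProduct; cartesianProductWith)
open import Data.List.Membership.DecPropositional _≟ᶜ_ using (_∈?_)
open import Data.List.Membership.Propositional using (_∈_)
open import Data.List.Membership.Propositional.Properties using (∈-allFin; ∈-map⁺; ∈-map⁻; ∈-filter⁺; ∈-filter⁻; ∈-upTo⁻; ∈-concatMap⁻; ∈-cartesianProduct⁺; ∈-cartesianProductWith⁺)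
open import Data.List.Membership.Propositional.Properties.WithK using (unique∧set⇒bag)
open import Data.List.Properties using (map-++; map-cong; map-∘; map-tabulate; length-map; length-tabulate; filter-accept; filter-reject; filter-all; filter-none; filter-++)
open import Data.List.Relation.Binary.BagAndSetEquality using (∼bag⇒↭)
open import Data.List.Relation.Binary.Permutation.Propositional as ↭ using (_↭_; prep; swap)
open import Data.List.Relation.Binary.Permutation.Propositional.Properties using (filter-↭)
open import Data.List.Relation.Unary.All as All using (All; []; _∷_; all?)
import Data.List.Relation.Unary.All.Properties as All
open import Data.List.Relation.Unary.AllPairs as AllPairs using (AllPairs; []; _∷_; allPairs?)
import Data.List.Relation.Unary.AllPairs.Properties as AllPairs
open import Data.List.Relation.Unary.Any using (satisfied)
open import Data.List.Relation.Unary.Unique.Propositional using (Unique)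
import Data.List.Relation.Unary.Unique.Propositional.Properties as Unique
import Data.List.Relation.Unary.Unique.Setoid as Uniqueₛ
import Data.List.Relation.Unary.Unique.Setoid.Properties as Uniqueₛ
open import Data.Nat.Base using (ℕ; zero; suc; _+_; _*_; _∸_; _/_; _%_; _^_; _!; _≤_; _<_; s≤s; NonZero)
open import Data.Nat.Combinatorics using (_C_; nCn≡1; k>n⇒nCk≡0; nCk+nC[k+1]≡[n+1]C[k+1])
open import Data.Nat.Divisibility using (m∣m*n)
open import Data.Nat.DivMod using (+-distrib-/-∣ˡ; m*n/n≡m; m<n⇒m/n≡0; m<n*o⇒m/o<n; m%n<n; m≡m%n+[m/n]*n)
open import Data.Nat.ListAction using (sum)
open import Data.Nat.ListAction.Properties using (sum-++)
open import Data.Nat.Properties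
open import Data.Nat.Tactic.RingSolver using (solve-∀)
open import Data.Product.Base using (_×_; _,_; proj₁; proj₂; map₂)
open import Data.Vec.Base as Vec using (Vec; []; _∷_; lookup; removeAt; toList)
open import Data.Vec.Membership.Propositional.Properties using (∈-tabulate⁺; ∈-toList⁺)
import Data.Vec.Properties as Vec
open import Function.Base using (id; _∘_)
open import Function.Bundles using (mk⇔)
open import Level using (0ℓ)
open import Relation.Binary.Bundles using (Setoid)
open import Relation.Binary.Definitions using (Symmetric) renaming (Decidable to Decidable₂)
open import Relation.Binary.PropositionalEquality as ≡ using (_≡_; _≢_; _≗_; refl; sym; trans; cong; cong₂; subst; module ≡-Reasoning)
open import Relation.Nullary.Decidable using (Dec; yes; no; does; ¬?; dec-true; dec-false)
open import Relation.Nullary.Negation using (¬_)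
open import Relation.Unary using (Decidable)

-- The two sides of the count have different shapes: rook numbers count sublists of the cells of a
-- board, in the order of the board, while hits come from exponents and permutations. Both are
-- reduced to `rooks`, for which the board is a matrix whose entry at column c and level l is the
-- number of its cells there. For the sublists this needs that their count does not depend on the
-- order of the cells, and that a rook removes from the remaining columns exactly the m rows of its
-- level.
--
-- The obstacle in the expansion is a column whose rook is not among the j marked ones. That rook
-- still occupies some level, so the remaining columns see one level fewer, and the induction
-- hypothesis yields a sum of rook counts over all choices of the deleted level. `∑-delete-level`
-- evaluates this sum: a placement of marked rooks survives the deletion of just those levels that
-- it leaves free. The numbers of free levels multiply up to (N-j)!, and the m cells of each chosen
-- level to m^(N-j).
--
-- Hit numbers count placements as sets of cells, so injectivity of R is what lets them be counted
-- over the group.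

private
  variable
    A X Y Z : Set
    n : ℕ

-- Finite sums

+-rotate : ∀ a b c → a + (b + c) ≡ b + (a + c)
+-rotate = solve-∀

∑ : List X → (X → ℕ) → ℕ
∑ xs f = sum (map f xs)

∑-cong : {f g : X → ℕ} → f ≗ g → ∀ xs → ∑ xs f ≡ ∑ xs g
∑-cong f≗g xs = cong sum (map-cong f≗g xs)

∑-cong-All : {f g : X → ℕ} {xs : List X} → All (λ x → f x ≡ g x) xs → ∑ xs f ≡ ∑ xs g
∑-cong-All []         = refl
∑-cong-All (eq ∷ eqs) = cong₂ _+_ eq (∑-cong-All eqs)

∑-++ : (xs ys : List X) (f : X → ℕ) → ∑ (xs ++ ys) f ≡ ∑ xs f + ∑ ys f
∑-++ xs ys f = trans (cong sum (map-++ f xs ys)) (sum-++ (map f xs) (map f ys))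

∑-map : (g : X → Y) (xs : List X) (f : Y → ℕ) → ∑ (map g xs) f ≡ ∑ xs (f ∘ g)
∑-map g xs f = cong sum (sym (map-∘ xs))

∑-cartesianProductWith : (g : X → Y → Z) (xs : List X) (ys : List Y) (f : Z → ℕ) →
  ∑ (cartesianProductWith g xs ys) f ≡ ∑ xs (λ x → ∑ ys (λ y → f (g x y)))
∑-cartesianProductWith g []       ys f = refl
∑-cartesianProductWith g (x ∷ xs) ys f =
  trans (∑-++ (map (g x) ys) _ f)
        (cong₂ _+_ (∑-map (g x) ys f) (∑-cartesianProductWith g xs ys f))

∑-+ : (xs : List X) (f g : X → ℕ) → ∑ xs (λ x → f x + g x) ≡ ∑ xs f + ∑ xs g
∑-+ []       f g = refl
∑-+ (x ∷ xs) f g = trans (cong (f x + g x +_) (∑-+ xs f g)) (+-interchange (f x) _ _ _)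
  where
  +-interchange : ∀ a b c d → a + b + (c + d) ≡ a + c + (b + d)
  +-interchange = solve-∀

∑-*ˡ : (a : ℕ) (xs : List X) (f : X → ℕ) → ∑ xs (λ x → a * f x) ≡ a * ∑ xs f
∑-*ˡ a []       f = sym (*-zeroʳ a)
∑-*ˡ a (x ∷ xs) f = trans (cong (a * f x +_) (∑-*ˡ a xs f)) (sym (*-distribˡ-+ a _ _))

∑-*ʳ : (a : ℕ) (xs : List X) (f : X → ℕ) → ∑ xs (λ x → f x * a) ≡ ∑ xs f * a
∑-*ʳ a xs f =
  trans (∑-cong (λ x → *-comm (f x) a) xs) (trans (∑-*ˡ a xs f) (*-comm a _))

∑-const : (xs : List X) (a : ℕ) → ∑ xs (λ _ → a) ≡ length xs * a
∑-const []       a = refl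
∑-const (x ∷ xs) a = cong (a +_) (∑-const xs a)

∑-swap : (xs : List X) (ys : List Y) (f : X → Y → ℕ) →
  ∑ xs (λ x → ∑ ys (f x)) ≡ ∑ ys (λ y → ∑ xs (λ x → f x y))
∑-swap []       ys f = sym (trans (∑-const ys 0) (*-zeroʳ (length ys)))
∑-swap (x ∷ xs) ys f = trans (cong (∑ ys (f x) +_) (∑-swap xs ys f)) (sym (∑-+ ys (f x) _))

𝟙 : {P : Set} → Dec P → ℕ
𝟙 P? = if does P? then 1 else 0

𝟙-yes : {P : Set} (P? : Dec P) → P → 𝟙 P? ≡ 1
𝟙-yes P? p = cong (if_then 1 else 0) (dec-true P? p)

𝟙-no : {P : Set} (P? : Dec P) → ¬ P → 𝟙 P? ≡ 0
𝟙-no P? ¬p = cong (if_then 1 else 0) (dec-false P? ¬p)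

length-filter≡∑ : {P : X → Set} (P? : Decidable P) (xs : List X) →
  length (filter P? xs) ≡ ∑ xs (λ x → 𝟙 (P? x))
length-filter≡∑ P? []       = refl
length-filter≡∑ P? (x ∷ xs) with does (P? x)
... | true  = cong suc (length-filter≡∑ P? xs)
... | false = length-filter≡∑ P? xs

-- Binomial moments

countEq : ℕ → List ℕ → ℕ
countEq k xs = ∑ xs (λ x → 𝟙 (x ≟ k))

moment : ℕ → List ℕ → ℕ
moment j xs = ∑ xs (_C j)

private
  below : ℕ → List ℕ → List ℕ
  below M = filter (_<? M)

  moment-top : ∀ M {xs} → All (_< suc M) xs → moment M xs ≡ countEq M xs
  moment-top M xs<M = ∑-cong-All (All.map pointwise xs<M)
    where
    pointwise : ∀ {x} → x < suc M → x C M ≡ 𝟙 (x ≟ M)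
    pointwise {x} x<1+M with x ≟ M
    ... | yes refl = trans (nCn≡1 x) (sym (𝟙-yes (x ≟ x) refl))
    ... | no  x≢M  = trans (k>n⇒nCk≡0 (≤∧≢⇒< (≤-pred x<1+M) x≢M)) (sym (𝟙-no (x ≟ M) x≢M))

  -- The function f stays arbitrary because the largest value is split off from two kinds of sums:
  -- the indicator of k gives the counts, `_C j` gives the moments.
  ∑-below : ∀ M (f : ℕ → ℕ) {xs} → All (_< suc M) xs →
    ∑ xs f ≡ f M * countEq M xs + ∑ (below M xs) f
  ∑-below M f {[]}     []              = sym (cong (_+ 0) (*-zeroʳ (f M)))
  ∑-below M f {x ∷ xs} (x<1+M ∷ xs<1+M) with x ≟ M
  ... | yes refl = begin
    f x + ∑ xs f                                        ≡⟨ cong (f x +_) (∑-below M f xs<1+M) ⟩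
    f x + (f x * countEq x xs + ∑ (below x xs) f)       ≡⟨ absorb (f x) (countEq x xs) _ ⟩
    f x * (1 + countEq x xs) + ∑ (below x xs) f
      ≡⟨ cong₂ (λ i ys → f x * (i + countEq x xs) + ∑ ys f)
           (𝟙-yes (x ≟ x) refl) (filter-reject (_<? x) (<-irrefl refl)) ⟨
    f x * countEq x (x ∷ xs) + ∑ (below x (x ∷ xs)) f   ∎
    where
    open ≡-Reasoning
    absorb : ∀ a b c → a + (a * b + c) ≡ a * (1 + b) + c
    absorb = solve-∀
  ... | no x≢M = begin
    f x + ∑ xs f                                        ≡⟨ cong (f x +_) (∑-below M f xs<1+M) ⟩
    f x + (f M * countEq M xs + ∑ (below M xs) f)       ≡⟨ +-rotate (f x) (f M * countEq M xs) _ ⟩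
    f M * countEq M xs + ∑ (x ∷ below M xs) f
      ≡⟨ cong₂ (λ i ys → f M * (i + countEq M xs) + ∑ ys f)
           (𝟙-no (x ≟ M) x≢M) (filter-accept (_<? M) (≤∧≢⇒< (≤-pred x<1+M) x≢M)) ⟨
    f M * countEq M (x ∷ xs) + ∑ (below M (x ∷ xs)) f   ∎
    where open ≡-Reasoning

  all-below : ∀ M xs → All (_< M) (below M xs)
  all-below M xs = All.all-filter (_<? M) xs

  bounded⇒countEq : ∀ M {xs ys} → All (_< M) xs → All (_< M) ys →
    (∀ j → moment j xs ≡ moment j ys) → ∀ k → countEq k xs ≡ countEq k ys
  bounded⇒countEq zero    []  []  eq k = refl
  bounded⇒countEq (suc M) {xs} {ys} xs< ys< eq k = begin
    countEq k xs                                       ≡⟨ ∑-below M δ xs< ⟩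
    δ M * countEq M xs + countEq k (below M xs)
      ≡⟨ cong₂ _+_ (cong (δ M *_) eq-top)
           (bounded⇒countEq M (all-below M xs) (all-below M ys) eq-below k) ⟩
    δ M * countEq M ys + countEq k (below M ys)        ≡⟨ ∑-below M δ ys< ⟨
    countEq k ys                                       ∎
    where
    open ≡-Reasoning
    δ : ℕ → ℕ
    δ x = 𝟙 (x ≟ k)
    eq-top : countEq M xs ≡ countEq M ys
    eq-top = trans (sym (moment-top M xs<)) (trans (eq M) (moment-top M ys<))
    eq-below : ∀ j → moment j (below M xs) ≡ moment j (below M ys)
    -- The value M contributes equally to both moments, since it occurs equally often in both lists.
    -- Cancelling this contribution carries the hypothesis over to the smaller values.
    eq-below j = +-cancelˡ-≡ ((M C j) * countEq M xs) _ _ (begin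
      (M C j) * countEq M xs + moment j (below M xs)  ≡⟨ ∑-below M (_C j) xs< ⟨
      moment j xs                                     ≡⟨ eq j ⟩
      moment j ys                                     ≡⟨ ∑-below M (_C j) ys< ⟩
      (M C j) * countEq M ys + moment j (below M ys)  ≡⟨ cong (λ c → (M C j) * c + moment j (below M ys)) eq-top ⟨
      (M C j) * countEq M xs + moment j (below M ys)  ∎)

  all≤sum : ∀ xs → All (_≤ sum xs) xs
  all≤sum []       = []
  all≤sum (x ∷ xs) = m≤m+n x _ ∷ All.map (λ y≤ → ≤-trans y≤ (m≤n+m _ x)) (all≤sum xs)

-- Triangular inversion: among values at most M, the binomial x C M is the
-- indicator of x ≡ M, so the largest value can be split off.
moments⇒countEq : ∀ xs ys → (∀ j → moment j xs ≡ moment j ys) → ∀ k → countEq k xs ≡ countEq k ys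
moments⇒countEq xs ys =
  -- Any common strict bound on the entries serves; the sum of all of them dominates each one.
  bounded⇒countEq (suc (sum xs + sum ys))
    (All.map (λ x≤ → s≤s (≤-trans x≤ (m≤m+n _ (sum ys)))) (all≤sum xs))
    (All.map (λ y≤ → s≤s (≤-trans y≤ (m≤n+m _ (sum xs)))) (all≤sum ys))

-- Placements by columns

select : List A → List (A × List A)
select []       = []
select (x ∷ xs) = (x , xs) ∷ map (map₂ (x ∷_)) (select xs)

length-select : (xs : List A) → length (select xs) ≡ length xs
length-select []       = refl
length-select (x ∷ xs) = cong suc (trans (length-map (map₂ (x ∷_)) (select xs)) (length-select xs))

select-length : (xs : List A) → All (λ (_ , ys) → length xs ≡ suc (length ys)) (select xs)
select-length []       = []
select-length (x ∷ xs) = refl ∷ All.map⁺ (All.map (cong suc) (select-length xs))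

-- Two picks leave the same remainder in either order. The induction separates the pairs of picks in
-- which the head x comes first, those in which it comes second, and those within the tail; the
-- first two groups trade places.
∑-select-swap : (f : A → A → List A → ℕ) (xs : List A) →
  ∑ (select xs) (λ (x , ys) → ∑ (select ys) (λ (y , zs) → f x y zs)) ≡
  ∑ (select xs) (λ (x , ys) → ∑ (select ys) (λ (y , zs) → f y x zs))
∑-select-swap f []       = refl
∑-select-swap f (x ∷ xs) = begin
  from-x + ∑ (map (map₂ (x ∷_)) S) (λ (y , ys) → ∑ (select ys) (λ (z , zs) → f y z zs))
    ≡⟨ cong (from-x +_) (unfold f) ⟩
  from-x + (to-x + ∑ S (λ (y , ys) → ∑ (select ys) (λ (z , zs) → f y z (x ∷ zs))))
    ≡⟨ cong (λ s → from-x + (to-x + s)) (∑-select-swap (λ y z zs → f y z (x ∷ zs)) xs) ⟩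
  from-x + (to-x + ∑ S (λ (y , ys) → ∑ (select ys) (λ (z , zs) → f z y (x ∷ zs))))
    ≡⟨ +-rotate from-x to-x _ ⟩
  to-x + (from-x + ∑ S (λ (y , ys) → ∑ (select ys) (λ (z , zs) → f z y (x ∷ zs))))
    ≡⟨ cong (to-x +_) (unfold (λ y z → f z y)) ⟨
  to-x + ∑ (map (map₂ (x ∷_)) S) (λ (y , ys) → ∑ (select ys) (λ (z , zs) → f z y zs))
    ∎
  where
  open ≡-Reasoning
  S = select xs
  from-x = ∑ S (λ (y , ys) → f x y ys)
  to-x   = ∑ S (λ (y , ys) → f y x ys)
  unfold : ∀ g →
    ∑ (map (map₂ (x ∷_)) S) (λ (y , ys) → ∑ (select ys) (λ (z , zs) → g y z zs)) ≡
    ∑ S (λ (y , ys) → g y x ys) + ∑ S (λ (y , ys) → ∑ (select ys) (λ (z , zs) → g y z (x ∷ zs)))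
  unfold g = begin
    ∑ (map (map₂ (x ∷_)) S) (λ (y , ys) → ∑ (select ys) (λ (z , zs) → g y z zs))
      ≡⟨ ∑-map (map₂ (x ∷_)) S _ ⟩
    ∑ S (λ (y , ys) → g y x ys + ∑ (map (map₂ (x ∷_)) (select ys)) (λ (z , zs) → g y z zs))
      ≡⟨ ∑-cong (λ (y , ys) → cong (g y x ys +_) (∑-map (map₂ (x ∷_)) (select ys) _)) S ⟩
    ∑ S (λ (y , ys) → g y x ys + ∑ (select ys) (λ (z , zs) → g y z (x ∷ zs)))
      ≡⟨ ∑-+ S _ _ ⟩
    _ ∎

module _ {X A : Set} (weight : X → A → ℕ) where

  -- The sum of the permanents of all k by k submatrices of the matrix `weight`, with columns from
  -- `cs` and levels from `ls`. The two summands distinguish whether column c holds a rook.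
  rooks : ℕ → List X → List A → ℕ
  rooks zero    cs       ls = 1
  rooks (suc k) []       ls = 0
  rooks (suc k) (c ∷ cs) ls =
    rooks (suc k) cs ls + ∑ (select ls) (λ (l , ls′) → weight c l * rooks k cs ls′)

  rooks-vanish : ∀ k cs ls → length cs < k → rooks k cs ls ≡ 0
  rooks-vanish (suc k) []       ls _         = refl
  rooks-vanish (suc k) (c ∷ cs) ls (s≤s len) = cong₂ _+_ (rooks-vanish (suc k) cs ls (m<n⇒m<1+n len))
    (trans (∑-cong (λ (l , ls′) → trans (cong (weight c l *_) (rooks-vanish k cs ls′ len))
                                         (*-zeroʳ (weight c l))) (select ls))
      (trans (∑-const (select ls) 0) (*-zeroʳ (length (select ls)))))

  -- A placement of k rooks survives the deletion of length ls - k levels.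
  ∑-delete-level : ∀ k cs ls →
    ∑ (select ls) (λ (_ , ls′) → rooks k cs ls′) + k * rooks k cs ls ≡ length ls * rooks k cs ls
  ∑-delete-level zero    cs ls =
    trans (+-identityʳ _) (trans (∑-const (select ls) 1) (cong (_* 1) (length-select ls)))
  ∑-delete-level (suc k) [] ls =
    trans (cong₂ _+_ (trans (∑-const (select ls) 0) (*-zeroʳ (length (select ls)))) (*-zeroʳ (suc k)))
          (sym (*-zeroʳ (length ls)))
  ∑-delete-level (suc k) (c ∷ cs) ls = begin
    ∑ S (λ (_ , ls′) → rooks (suc k) cs ls′ + with-c ls′) + suc k * (U + V)
      ≡⟨ cong (_+ suc k * (U + V)) (∑-+ S _ _) ⟩
    ∑U + ∑ S (λ (_ , ls′) → with-c ls′) + suc k * (U + V)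
      ≡⟨ cong (λ s → ∑U + s + suc k * (U + V)) swap-levels ⟩
    ∑U + W + suc k * (U + V)
      ≡⟨ regroup ∑U W k U V ⟩
    (∑U + suc k * U) + (W + (V + k * V))
      ≡⟨ cong₂ _+_ (∑-delete-level (suc k) cs ls) level-used ⟩
    length ls * U + length ls * V
      ≡⟨ *-distribˡ-+ (length ls) U V ⟨
    length ls * (U + V) ∎
    where
    open ≡-Reasoning
    S  = select ls
    with-c = λ ls′ → ∑ (select ls′) (λ (l , ls″) → weight c l * rooks k cs ls″)
    U  = rooks (suc k) cs ls
    V  = with-c ls
    ∑U = ∑ S (λ (_ , ls′) → rooks (suc k) cs ls′)
    W  = ∑ S (λ (l , ls′) → weight c l * ∑ (select ls′) (λ (_ , ls″) → rooks k cs ls″))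
    regroup : ∀ a b k u v → a + b + suc k * (u + v) ≡ (a + suc k * u) + (b + (v + k * v))
    regroup = solve-∀
    -- Deleting a level and then placing the rook of column c amounts to placing that rook and then
    -- deleting one of the other levels. The second order exposes a deletion sum over the remaining
    -- columns, to which induction applies.
    swap-levels : ∑ S (λ (_ , ls′) → with-c ls′) ≡ W
    swap-levels = trans (∑-select-swap (λ _ l ls″ → weight c l * rooks k cs ls″) ls)
      (∑-cong (λ (l , ls′) → ∑-*ˡ (weight c l) (select ls′) _) S)
    -- Once column c uses level l, induction on the other columns counts `length ls′` levels, one
    -- too few. The missing one is l itself, supplied by the extra summand V in `suc k * V`.
    level-used : W + (V + k * V) ≡ length ls * V
    level-used = begin
      W + (V + k * V)                      ≡⟨ cong (λ s → W + (V + s)) (∑-*ˡ k S _) ⟨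
      W + (V + ∑ S (λ (l , ls′) → k * (weight c l * rooks k cs ls′)))
        ≡⟨ cong (W +_) (∑-+ S _ _) ⟨
      W + ∑ S (λ (l , ls′) → weight c l * rooks k cs ls′ + k * (weight c l * rooks k cs ls′))
        ≡⟨ ∑-+ S _ _ ⟨
      ∑ S (λ (l , ls′) → weight c l * ∑ (select ls′) (λ (_ , ls″) → rooks k cs ls″)
                         + (weight c l * rooks k cs ls′ + k * (weight c l * rooks k cs ls′)))
        ≡⟨ ∑-cong-All (All.map (λ {(l , ls′)} → per-level l ls′) (select-length ls)) ⟩
      ∑ S (λ (l , ls′) → length ls * (weight c l * rooks k cs ls′))
        ≡⟨ ∑-*ˡ (length ls) S _ ⟩
      length ls * V ∎
      where
      collect : ∀ w d r k → w * d + (w * r + k * (w * r)) ≡ w * (r + (d + k * r))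
      collect = solve-∀
      pull : ∀ w r n → w * (r + n * r) ≡ suc n * (w * r)
      pull = solve-∀
      per-level : ∀ l ls′ → length ls ≡ suc (length ls′) →
        weight c l * ∑ (select ls′) (λ (_ , ls″) → rooks k cs ls″)
          + (weight c l * rooks k cs ls′ + k * (weight c l * rooks k cs ls′))
        ≡ length ls * (weight c l * rooks k cs ls′)
      per-level l ls′ len = begin
        _ ≡⟨ collect (weight c l) (∑ (select ls′) (λ (_ , ls″) → rooks k cs ls″)) (rooks k cs ls′) k ⟩
        weight c l * (rooks k cs ls′ + (∑ (select ls′) (λ (_ , ls″) → rooks k cs ls″) + k * rooks k cs ls′))
          ≡⟨ cong (λ s → weight c l * (rooks k cs ls′ + s)) (∑-delete-level k cs ls′) ⟩
        weight c l * (rooks k cs ls′ + length ls′ * rooks k cs ls′)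
          ≡⟨ pull (weight c l) (rooks k cs ls′) (length ls′) ⟩
        suc (length ls′) * (weight c l * rooks k cs ls′)
          ≡⟨ cong (_* (weight c l * rooks k cs ls′)) len ⟨
        _ ∎

∑-allFin-suc : (f : Fin (suc n) → ℕ) → ∑ (allFin (suc n)) f ≡ f zero + ∑ (allFin n) (f ∘ suc)
∑-allFin-suc f = trans (cong (λ ys → f zero + sum ys) (map-tabulate suc f))
                       (cong (λ ys → f zero + sum ys) (sym (map-tabulate id (f ∘ suc))))

lookup-punchIn : (xs : Vec A (suc n)) (i : Fin (suc n)) (j : Fin n) →
  lookup xs (punchIn i j) ≡ lookup (removeAt xs i) j
lookup-punchIn (x ∷ xs)     zero    j       = refl
lookup-punchIn (x ∷ y ∷ xs) (suc i) zero    = refl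
lookup-punchIn (x ∷ y ∷ xs) (suc i) (suc j) = lookup-punchIn (y ∷ xs) i j

-- Connects the two ways of deleting a level: permutations delete by index from a vector, whereas
-- `rooks` recurses on the pairs produced by `select`.
∑-removeAt : (f : A → List A → ℕ) (xs : Vec A (suc n)) →
  ∑ (allFin (suc n)) (λ i → f (lookup xs i) (toList (removeAt xs i))) ≡
  ∑ (select (toList xs)) (λ (x , ys) → f x ys)
∑-removeAt f (x ∷ [])     = refl
∑-removeAt f (x ∷ y ∷ xs) = trans (∑-allFin-suc (λ i → f (lookup (x ∷ y ∷ xs) i) _))
  (cong (f x (y ∷ toList xs) +_)
    (trans (∑-removeAt (λ z zs → f z (x ∷ zs)) (y ∷ xs)) (sym (∑-map (map₂ (x ∷_)) (select (y ∷ toList xs)) _))))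

∑-allFin-const : ∀ n a → ∑ (allFin n) (λ _ → a) ≡ n * a
∑-allFin-const n a = trans (∑-const (allFin n) a) (cong (_* a) (length-tabulate {n = n} id))

-- Binomial moments of the number of hits over the wreath product

cell : ∀ {m} → ℕ → ℕ → Fin m → Cell
cell {m} c l s = c , m * l + toℕ s

-- The number of ways to fill d remaining columns and levels.
completions : ℕ → ℕ → ℕ
completions m d = m ^ d * d !

completions-suc : ∀ m d → completions m (suc d) ≡ m * completions m d * suc d
completions-suc m d = rearrange m (m ^ d) (d !) d
  where
  rearrange : ∀ a b c d → a * b * (c + d * c) ≡ a * (b * c) * suc d
  rearrange = solve-∀

module _ (m : ℕ) {P : Cell → Set} (P? : Decidable P) where

  cellsInLevel : ℕ → ℕ → ℕ
  cellsInLevel c l = ∑ (allFin m) (λ s → 𝟙 (P? (cell c l s)))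

  -- Columns and levels are arbitrary vectors of labels, so that the same notion applies after a
  -- column and a level have been deleted.
  hits : Vec ℕ n → Vec ℕ n → Vec (Fin m) n → Permutation′ n → ℕ
  hits {n} cs ls v σ = ∑ (allFin n) (λ i → 𝟙 (P? (cell (lookup cs i) (lookup ls (σ ⟨$⟩ʳ i)) (lookup v i))))

  -- The permutation `insert zero l ρ` sends the first column to index l and the others through
  -- `punchIn l`, and indexing `ls` through `punchIn l` is indexing the vector with that entry
  -- removed.
  hits-insert : ∀ c (cs : Vec ℕ n) ls s v l ρ →
    hits (c ∷ cs) ls (s ∷ v) (insert zero l ρ) ≡
    𝟙 (P? (cell c (lookup ls l) s)) + hits cs (removeAt ls l) v ρ
  hits-insert {n} c cs ls s v l ρ = trans
    (∑-allFin-suc (λ i → 𝟙 (P? (cell (lookup (c ∷ cs) i) (lookup ls (insert zero l ρ ⟨$⟩ʳ i)) (lookup (s ∷ v) i)))))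
    (cong (𝟙 (P? (cell c (lookup ls l) s)) +_) (∑-cong
      (λ i → cong (λ l′ → 𝟙 (P? (cell (lookup cs i) l′ (lookup v i))))
        (trans (cong (lookup ls) (insert-punchIn zero l ρ i)) (lookup-punchIn ls l (ρ ⟨$⟩ʳ i))))
      (allFin n)))

  -- The statistic φ is general because expanding along the first column replaces it by its shift by
  -- 0 or 1, according to whether the rook there is a hit.
  ∑-hits : (ℕ → ℕ) → Vec ℕ n → Vec ℕ n → ℕ
  ∑-hits {n} φ cs ls =
    ∑ (allVecs (allFin m) n) (λ v → ∑ (allPermutations n) (λ σ → φ (hits cs ls v σ)))

  ∑-hits-cong : ∀ {φ ψ} → φ ≗ ψ → (cs ls : Vec ℕ n) → ∑-hits φ cs ls ≡ ∑-hits ψ cs ls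
  ∑-hits-cong {n} φ≗ψ cs ls = ∑-cong (λ v → ∑-cong (λ σ → φ≗ψ _) (allPermutations n)) (allVecs (allFin m) n)

  ∑-hits-+ : ∀ φ ψ (cs ls : Vec ℕ n) →
    ∑-hits (λ h → φ h + ψ h) cs ls ≡ ∑-hits φ cs ls + ∑-hits ψ cs ls
  ∑-hits-+ {n} φ ψ cs ls = trans
    (∑-cong (λ v → ∑-+ (allPermutations n) _ _) (allVecs (allFin m) n))
    (∑-+ (allVecs (allFin m) n) _ _)

  ∑-hits-* : ∀ a φ (cs ls : Vec ℕ n) → ∑-hits (λ h → a * φ h) cs ls ≡ a * ∑-hits φ cs ls
  ∑-hits-* {n} a φ cs ls = trans
    (∑-cong (λ v → ∑-*ˡ a (allPermutations n) _) (allVecs (allFin m) n))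
    (∑-*ˡ a (allVecs (allFin m) n) _)

  ∑-hits-∷ : ∀ φ c (cs : Vec ℕ n) ls →
    ∑-hits φ (c ∷ cs) ls ≡
    ∑ (allFin (suc n)) (λ l → ∑ (allFin m) (λ s →
      ∑-hits (λ h → φ (𝟙 (P? (cell c (lookup ls l) s)) + h)) cs (removeAt ls l)))
  ∑-hits-∷ {n} φ c cs ls = begin
    ∑-hits φ (c ∷ cs) ls
      ≡⟨ ∑-cartesianProductWith _∷_ ss vs _ ⟩
    ∑ ss (λ s → ∑ vs (λ v → ∑ (allPermutations (suc n)) (λ σ → φ (hits (c ∷ cs) ls (s ∷ v) σ))))
      ≡⟨ ∑-cong (λ s → ∑-cong (λ v → ∑-cartesianProductWith (insert zero) is ps _) vs) ss ⟩
    ∑ ss (λ s → ∑ vs (λ v → ∑ is (λ l → ∑ ps (λ ρ → φ (hits (c ∷ cs) ls (s ∷ v) (insert zero l ρ))))))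
      ≡⟨ ∑-cong (λ s → ∑-swap vs is _) ss ⟩
    ∑ ss (λ s → ∑ is (λ l → ∑ vs (λ v → ∑ ps (λ ρ → φ (hits (c ∷ cs) ls (s ∷ v) (insert zero l ρ))))))
      ≡⟨ ∑-swap ss is _ ⟩
    ∑ is (λ l → ∑ ss (λ s → ∑ vs (λ v → ∑ ps (λ ρ → φ (hits (c ∷ cs) ls (s ∷ v) (insert zero l ρ))))))
      ≡⟨ ∑-cong (λ l → ∑-cong (λ s → ∑-cong (λ v → ∑-cong (λ ρ →
           cong φ (hits-insert c cs ls s v l ρ)) ps) vs) ss) is ⟩
    _ ∎
    where
    open ≡-Reasoning
    ss = allFin m
    is = allFin (suc n)
    vs = allVecs (allFin m) n
    ps = allPermutations n

  private
    pascal : {Q : Set} (Q? : Dec Q) (h j : ℕ) → (𝟙 Q? + h) C suc j ≡ h C suc j + 𝟙 Q? * (h C j)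
    pascal (yes _) h j = trans (sym (nCk+nC[k+1]≡[n+1]C[k+1] h j))
      (trans (+-comm (h C j) _) (cong (h C suc j +_) (sym (+-identityʳ (h C j)))))
    pascal (no _)  h j = sym (+-identityʳ _)

  -- Pascal's rule decides whether the rook of the first column is among the marked hits. If not,
  -- any of the m cells of its level will do; if so, only the cells satisfying P count, and j marks
  -- remain for the other columns.
  ∑-hits-C-suc : ∀ j c (cs : Vec ℕ n) ls →
    ∑-hits (_C suc j) (c ∷ cs) ls ≡
    ∑ (allFin (suc n)) (λ l → m * ∑-hits (_C suc j) cs (removeAt ls l) +
                               cellsInLevel c (lookup ls l) * ∑-hits (_C j) cs (removeAt ls l))
  ∑-hits-C-suc {n} j c cs ls = trans (∑-hits-∷ (_C suc j) c cs ls) (∑-cong per-level (allFin (suc n)))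
    where
    open ≡-Reasoning
    δ : Fin (suc n) → Fin m → ℕ
    δ l s = 𝟙 (P? (cell c (lookup ls l) s))
    per-level : ∀ l →
      ∑ (allFin m) (λ s → ∑-hits (λ h → (δ l s + h) C suc j) cs (removeAt ls l)) ≡
      m * ∑-hits (_C suc j) cs (removeAt ls l) + cellsInLevel c (lookup ls l) * ∑-hits (_C j) cs (removeAt ls l)
    per-level l = begin
      ∑ (allFin m) (λ s → ∑-hits (λ h → (δ l s + h) C suc j) cs (removeAt ls l))
        ≡⟨ ∑-cong (λ s → trans (∑-hits-cong (λ h → pascal (P? (cell c (lookup ls l) s)) h j) cs (removeAt ls l))
             (trans (∑-hits-+ (_C suc j) (λ h → δ l s * (h C j)) cs (removeAt ls l))
                    (cong (G +_) (∑-hits-* (δ l s) (_C j) cs (removeAt ls l))))) (allFin m) ⟩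
      ∑ (allFin m) (λ s → G + δ l s * G′)
        ≡⟨ ∑-+ (allFin m) _ _ ⟩
      ∑ (allFin m) (λ _ → G) + ∑ (allFin m) (λ s → δ l s * G′)
        ≡⟨ cong₂ _+_ (∑-allFin-const m G) (∑-*ʳ G′ (allFin m) (δ l)) ⟩
      m * G + cellsInLevel c (lookup ls l) * G′ ∎
      where
      G  = ∑-hits (_C suc j) cs (removeAt ls l)
      G′ = ∑-hits (_C j) cs (removeAt ls l)

  rookWeight : ℕ → List ℕ → List ℕ → ℕ
  rookWeight = rooks cellsInLevel

  ∑-hits-C : ∀ j (cs ls : Vec ℕ n) →
    ∑-hits (_C j) cs ls ≡ completions m (n ∸ j) * rookWeight j (toList cs) (toList ls)
  ∑-hits-C zero    []       [] = refl
  ∑-hits-C (suc j) []       [] = refl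
  ∑-hits-C {suc n} zero    (c ∷ cs) ls = begin
    ∑-hits (_C 0) (c ∷ cs) ls
      ≡⟨ ∑-hits-∷ (_C 0) c cs ls ⟩
    ∑ (allFin (suc n)) (λ l → ∑ (allFin m) (λ s → ∑-hits (_C 0) cs (removeAt ls l)))
      ≡⟨ ∑-cong (λ l → trans (∑-allFin-const m _) (cong (m *_)
           (trans (∑-hits-C 0 cs (removeAt ls l)) (*-identityʳ (completions m n))))) (allFin (suc n)) ⟩
    ∑ (allFin (suc n)) (λ l → m * completions m n)
      ≡⟨ ∑-allFin-const (suc n) (m * completions m n) ⟩
    suc n * (m * completions m n)
      ≡⟨ trans (*-comm (suc n) _) (sym (completions-suc m n)) ⟩
    completions m (suc n)
      ≡⟨ *-identityʳ _ ⟨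
    completions m (suc n) * 1 ∎
    where open ≡-Reasoning
  ∑-hits-C {suc n} (suc j) (c ∷ cs) ls = begin
    ∑-hits (_C suc j) (c ∷ cs) ls
      ≡⟨ ∑-hits-C-suc j c cs ls ⟩
    ∑ (allFin (suc n)) (λ l → m * ∑-hits (_C suc j) cs (removeAt ls l) +
                               w (lookup ls l) * ∑-hits (_C j) cs (removeAt ls l))
      ≡⟨ ∑-cong (λ l → cong₂ (λ x y → m * x + w (lookup ls l) * y)
           (∑-hits-C (suc j) cs (removeAt ls l)) (∑-hits-C j cs (removeAt ls l))) (allFin (suc n)) ⟩
    ∑ (allFin (suc n)) (λ l → m * (f′ * r (suc j) (toList (removeAt ls l))) +
                               w (lookup ls l) * (f * r j (toList (removeAt ls l))))
      ≡⟨ ∑-removeAt (λ l ls′ → m * (f′ * r (suc j) ls′) + w l * (f * r j ls′)) ls ⟩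
    ∑ S (λ (l , ls′) → m * (f′ * r (suc j) ls′) + w l * (f * r j ls′))
      ≡⟨ ∑-cong (λ (l , ls′) → regroup m f′ (r (suc j) ls′) (w l) f (r j ls′)) S ⟩
    ∑ S (λ (l , ls′) → m * f′ * r (suc j) ls′ + f * (w l * r j ls′))
      ≡⟨ ∑-+ S _ _ ⟩
    ∑ S (λ (l , ls′) → m * f′ * r (suc j) ls′) + ∑ S (λ (l , ls′) → f * (w l * r j ls′))
      ≡⟨ cong₂ _+_ (∑-*ˡ (m * f′) S _) (∑-*ˡ f S _) ⟩
    m * f′ * ∑ S (λ (_ , ls′) → r (suc j) ls′) + f * ∑ S (λ (l , ls′) → w l * r j ls′)
      ≡⟨ cong (_+ f * ∑ S (λ (l , ls′) → w l * r j ls′)) unused-column ⟩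
    f * r (suc j) (toList ls) + f * ∑ S (λ (l , ls′) → w l * r j ls′)
      ≡⟨ *-distribˡ-+ f _ _ ⟨
    f * rookWeight (suc j) (c ∷ toList cs) (toList ls) ∎
    where
    open ≡-Reasoning
    S  = select (toList ls)
    f  = completions m (n ∸ j)
    f′ = completions m (n ∸ suc j)
    w  = cellsInLevel c
    r : ℕ → List ℕ → ℕ
    r k = rookWeight k (toList cs)
    regroup : ∀ a b c d e g → a * (b * c) + d * (e * g) ≡ a * b * c + e * (d * g)
    regroup = solve-∀
    -- The unmarked rook of the first column has m cells in each of the n - j levels that the j + 1
    -- marked rooks leave free. This raises the factor from `f′` to `f`.
    unused-column : m * f′ * ∑ S (λ (_ , ls′) → r (suc j) ls′) ≡ f * r (suc j) (toList ls)
    unused-column with j <? n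
    ... | yes j<n = begin
      m * f′ * ∑ S (λ (_ , ls′) → r (suc j) ls′)    ≡⟨ cong (m * f′ *_) ∑≡ ⟩
      m * f′ * (suc (n ∸ suc j) * ρ)                ≡⟨ *-assoc (m * f′) _ _ ⟨
      m * f′ * suc (n ∸ suc j) * ρ                  ≡⟨ cong (_* ρ) (completions-suc m (n ∸ suc j)) ⟨
      completions m (suc (n ∸ suc j)) * ρ           ≡⟨ cong (λ d → completions m d * ρ) (+-∸-assoc 1 j<n) ⟨
      f * ρ ∎
      where
      ρ = r (suc j) (toList ls)
      ∑≡ : ∑ S (λ (_ , ls′) → r (suc j) ls′) ≡ suc (n ∸ suc j) * ρ
      ∑≡ = +-cancelʳ-≡ (suc j * ρ) _ _ (begin
        ∑ S (λ (_ , ls′) → r (suc j) ls′) + suc j * ρ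
          ≡⟨ ∑-delete-level cellsInLevel (suc j) (toList cs) (toList ls) ⟩
        length (toList ls) * ρ
          ≡⟨ cong (_* ρ) (Vec.length-toList ls) ⟩
        suc n * ρ
          ≡⟨ cong (λ d → suc d * ρ) (m∸n+n≡m j<n) ⟨
        suc (n ∸ suc j + suc j) * ρ
          ≡⟨ *-distribʳ-+ ρ (suc (n ∸ suc j)) (suc j) ⟩
        suc (n ∸ suc j) * ρ + suc j * ρ ∎)
    -- For j at least n the truncated subtraction breaks the recursion of `completions`, but both
    -- sides are 0: the n remaining columns cannot hold j + 1 rooks.
    ... | no j≮n = begin
      m * f′ * ∑ S (λ (_ , ls′) → r (suc j) ls′)
        ≡⟨ cong (m * f′ *_) (trans (∑-cong (λ (_ , ls′) → vanish ls′) S)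
             (trans (∑-const S 0) (*-zeroʳ (length S)))) ⟩
      m * f′ * 0                ≡⟨ *-zeroʳ (m * f′) ⟩
      0                         ≡⟨ *-zeroʳ f ⟨
      f * 0                     ≡⟨ cong (f *_) (vanish (toList ls)) ⟨
      f * r (suc j) (toList ls) ∎
      where
      vanish : ∀ ls′ → r (suc j) ls′ ≡ 0
      vanish ls′ = rooks-vanish cellsInLevel (suc j) (toList cs) ls′
        (s≤s (≤-trans (≤-reflexive (Vec.length-toList cs)) (≮⇒≥ j≮n)))

-- Sums over filtered lists and their sublists

∑-filter : {P : X → Set} (P? : Decidable P) (xs : List X) (f : X → ℕ) →
  ∑ (filter P? xs) f ≡ ∑ xs (λ x → 𝟙 (P? x) * f x)
∑-filter P? []       f = refl
∑-filter P? (x ∷ xs) f with does (P? x)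
... | true  = cong₂ _+_ (sym (*-identityˡ (f x))) (∑-filter P? xs f)
... | false = ∑-filter P? xs f

filter-comm : {P Q : X → Set} (P? : Decidable P) (Q? : Decidable Q) (xs : List X) →
  filter P? (filter Q? xs) ≡ filter Q? (filter P? xs)
filter-comm P? Q? []       = refl
filter-comm P? Q? (x ∷ xs) with does (P? x) in p | does (Q? x) in q
... | true  | true  rewrite p | q = cong (x ∷_) (filter-comm P? Q? xs)
... | true  | false rewrite q     = filter-comm P? Q? xs
... | false | true  rewrite p     = filter-comm P? Q? xs
... | false | false               = filter-comm P? Q? xs

private
  if-∧ : ∀ a b → (if a ∧ b then 1 else 0) ≡ (if a then 1 else 0) * (if b then 1 else 0)
  if-∧ true  b = sym (*-identityˡ _)
  if-∧ false b = refl

-- A sublist of the filtered list is a sublist of the whole list all of whose members pass the test.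
-- Thus the demand that every later cell be compatible with a chosen one becomes a count on a
-- shorter list.
∑-choose-filter : {P : X → Set} (P? : Decidable P) (k : ℕ) (xs : List X) (f : List X → ℕ) →
  ∑ (choose k (filter P? xs)) f ≡ ∑ (choose k xs) (λ ys → 𝟙 (all? P? ys) * f ys)
∑-choose-filter P? zero    xs       f = cong (_+ 0) (sym (*-identityˡ (f [])))
∑-choose-filter P? (suc k) []       f = refl
∑-choose-filter P? (suc k) (x ∷ xs) f = trans split (sym (∑-++ (map (x ∷_) (choose k xs)) _ _))
  where
  open ≡-Reasoning
  with-x : ∑ (map (x ∷_) (choose k xs)) (λ ys → 𝟙 (all? P? ys) * f ys) ≡
           𝟙 (P? x) * ∑ (choose k (filter P? xs)) (f ∘ (x ∷_))
  with-x = begin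
    ∑ (map (x ∷_) (choose k xs)) (λ ys → 𝟙 (all? P? ys) * f ys)
      ≡⟨ ∑-map (x ∷_) (choose k xs) _ ⟩
    ∑ (choose k xs) (λ ys → 𝟙 (all? P? (x ∷ ys)) * f (x ∷ ys))
      ≡⟨ ∑-cong (λ ys → trans (cong (_* f (x ∷ ys)) (if-∧ (does (P? x)) (does (all? P? ys))))
                                (*-assoc (𝟙 (P? x)) _ _)) (choose k xs) ⟩
    ∑ (choose k xs) (λ ys → 𝟙 (P? x) * (𝟙 (all? P? ys) * f (x ∷ ys)))
      ≡⟨ ∑-*ˡ (𝟙 (P? x)) (choose k xs) _ ⟩
    𝟙 (P? x) * ∑ (choose k xs) (λ ys → 𝟙 (all? P? ys) * f (x ∷ ys))
      ≡⟨ cong (𝟙 (P? x) *_) (∑-choose-filter P? k xs (f ∘ (x ∷_))) ⟨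
    𝟙 (P? x) * ∑ (choose k (filter P? xs)) (f ∘ (x ∷_)) ∎
  split : ∑ (choose (suc k) (filter P? (x ∷ xs))) f ≡
          ∑ (map (x ∷_) (choose k xs)) (λ ys → 𝟙 (all? P? ys) * f ys) +
          ∑ (choose (suc k) xs) (λ ys → 𝟙 (all? P? ys) * f ys)
  split rewrite with-x with does (P? x)
  ... | false = ∑-choose-filter P? (suc k) xs f
  ... | true  = trans (∑-++ (map (x ∷_) (choose k (filter P? xs))) _ f)
    (cong₂ _+_ (trans (∑-map (x ∷_) (choose k (filter P? xs)) f) (sym (*-identityˡ _)))
               (∑-choose-filter P? (suc k) xs f))

-- Counting the k-element cliques of a relation

module _ {X : Set} {_~_ : X → X → Set} (_~?_ : Decidable₂ _~_) where

  cliques : ℕ → List X → ℕ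
  cliques k xs = ∑ (choose k xs) (λ ys → 𝟙 (allPairs? _~?_ ys))

  -- The cliques that contain x correspond to the k-element cliques among the elements of `xs`
  -- related to x.
  cliques-∷ : ∀ k x xs → cliques (suc k) (x ∷ xs) ≡ cliques k (filter (x ~?_) xs) + cliques (suc k) xs
  cliques-∷ k x xs = trans (∑-++ (map (x ∷_) (choose k xs)) _ _) (cong (_+ cliques (suc k) xs) (begin
    ∑ (map (x ∷_) (choose k xs)) (λ ys → 𝟙 (allPairs? _~?_ ys))
      ≡⟨ ∑-map (x ∷_) (choose k xs) _ ⟩
    ∑ (choose k xs) (λ ys → 𝟙 (allPairs? _~?_ (x ∷ ys)))
      ≡⟨ ∑-cong (λ ys → if-∧ (does (all? (x ~?_) ys)) (does (allPairs? _~?_ ys))) (choose k xs) ⟩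
    ∑ (choose k xs) (λ ys → 𝟙 (all? (x ~?_) ys) * 𝟙 (allPairs? _~?_ ys))
      ≡⟨ ∑-choose-filter (x ~?_) k xs _ ⟨
    cliques k (filter (x ~?_) xs) ∎))
    where open ≡-Reasoning

  -- A clique takes at most one element from a block of pairwise unrelated elements. In the
  -- application the block is one column of the board.
  cliques-++ : ∀ k xs ys → AllPairs (λ x y → ¬ x ~ y) xs →
    cliques (suc k) (xs ++ ys) ≡ ∑ xs (λ x → cliques k (filter (x ~?_) ys)) + cliques (suc k) ys
  cliques-++ k []       ys []             = refl
  cliques-++ k (x ∷ xs) ys (x≁xs ∷ xs≁xs) = begin
    cliques (suc k) (x ∷ xs ++ ys)
      ≡⟨ cliques-∷ k x (xs ++ ys) ⟩
    cliques k (filter (x ~?_) (xs ++ ys)) + cliques (suc k) (xs ++ ys)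
      ≡⟨ cong₂ (λ zs t → cliques k zs + t)
           (trans (filter-++ (x ~?_) xs ys) (cong (_++ filter (x ~?_) ys) (filter-none (x ~?_) x≁xs)))
           (cliques-++ k xs ys xs≁xs) ⟩
    cliques k (filter (x ~?_) ys) + (∑ xs (λ x → cliques k (filter (x ~?_) ys)) + cliques (suc k) ys)
      ≡⟨ +-assoc (cliques k (filter (x ~?_) ys)) _ _ ⟨
    _ ∎
    where open ≡-Reasoning

  module _ (~-sym : Symmetric _~_) where

    private
      swap-head : ∀ k x y xs → cliques k (x ∷ y ∷ xs) ≡ cliques k (y ∷ x ∷ xs)
      swap-head zero    x y xs = refl
      swap-head (suc k) x y xs = begin
        cliques (suc k) (x ∷ y ∷ xs)
          ≡⟨ trans (cliques-∷ k x (y ∷ xs)) (cong (cliques k (filter (x ~?_) (y ∷ xs)) +_) (cliques-∷ k y xs)) ⟩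
        cliques k (filter (x ~?_) (y ∷ xs)) + (cliques k (filter (y ~?_) xs) + cliques (suc k) xs)
          ≡⟨ exchange k ⟩
        cliques k (filter (y ~?_) (x ∷ xs)) + (cliques k (filter (x ~?_) xs) + cliques (suc k) xs)
          ≡⟨ trans (cliques-∷ k y (x ∷ xs)) (cong (cliques k (filter (y ~?_) (x ∷ xs)) +_) (cliques-∷ k x xs)) ⟨
        cliques (suc k) (y ∷ x ∷ xs) ∎
        where
        open ≡-Reasoning
        -- If x and y are unrelated, no clique contains both and the two single counts just change
        -- places. If they are related, the cliques through both are counted on the list filtered by
        -- x and by y, in either order.
        exchange : ∀ k {c} →
          cliques k (filter (x ~?_) (y ∷ xs)) + (cliques k (filter (y ~?_) xs) + c) ≡
          cliques k (filter (y ~?_) (x ∷ xs)) + (cliques k (filter (x ~?_) xs) + c)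
        exchange k {c} with x ~? y
        exchange k {c} | no x≁y
          rewrite filter-reject (y ~?_) {xs = xs} (x≁y ∘ ~-sym)
          = +-rotate (cliques k (filter (x ~?_) xs)) _ c
        exchange zero {c} | yes x~y = refl
        exchange (suc k) {c} | yes x~y
          rewrite filter-accept (y ~?_) {xs = xs} (~-sym x~y)
                | cliques-∷ k y (filter (x ~?_) xs)
                | cliques-∷ k x (filter (y ~?_) xs)
                | filter-comm (x ~?_) (y ~?_) xs
          = trans (+-assoc both _ _) (trans
              (cong (both +_) (+-rotate (cliques (suc k) (filter (x ~?_) xs)) _ c))
              (sym (+-assoc both _ _)))
          where both = cliques k (filter (y ~?_) (filter (x ~?_) xs))

    -- Needed because a board and the grid enumerate the same cells in different orders. The
    -- induction on k encloses that on the permutation: splitting off a head leaves filtered tails,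
    -- again permutations of each other, with one element fewer to choose.
    cliques-↭ : ∀ k {xs ys} → xs ↭ ys → cliques k xs ≡ cliques k ys
    cliques-↭ zero    p = refl
    cliques-↭ (suc k) p = go p
      where
      go-∷ : ∀ x {xs ys} → xs ↭ ys → cliques (suc k) xs ≡ cliques (suc k) ys →
        cliques (suc k) (x ∷ xs) ≡ cliques (suc k) (x ∷ ys)
      go-∷ x {xs} {ys} p eq = trans (cliques-∷ k x xs)
        (trans (cong₂ _+_ (cliques-↭ k (filter-↭ (x ~?_) p)) eq) (sym (cliques-∷ k x ys)))
      go : ∀ {xs ys} → xs ↭ ys → cliques (suc k) xs ≡ cliques (suc k) ys
      go ↭.refl        = refl
      go (prep x p)   = go-∷ x p (go p)
      go (swap x y p) = trans (swap-head (suc k) x y _) (go-∷ y (prep x p) (go-∷ x p (go p)))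
      go (↭.trans p q)  = trans (go p) (go q)

-- Rook placements on a subset of a square

map-proj₁-select : (xs : List A) → map proj₁ (select xs) ≡ xs
map-proj₁-select []       = refl
map-proj₁-select (x ∷ xs) = cong (x ∷_) (trans (sym (map-∘ (select xs))) (map-proj₁-select xs))

_≢?_ : Decidable₂ (_≢_ {A = ℕ})
l ≢? l′ = ¬? (l ≟ l′)

-- A rook strikes out its level by value, while `select` removes a position. Without repeated levels
-- the two agree.
select≡filter : {ls : List ℕ} → Unique ls →
  All (λ (l , ls′) → filter (l ≢?_) ls ≡ ls′) (select ls)
select≡filter []            = []
select≡filter {l ∷ ls} (l≢ls ∷ uls) =
  trans (filter-reject (l ≢?_) (λ l≢l → l≢l refl)) (filter-all (l ≢?_) l≢ls) ∷
  All.map⁺ (All.zipWith step (All.map⁻ (subst (All (l ≢_)) (sym (map-proj₁-select ls)) l≢ls) , select≡filter uls))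
  where
  step : ∀ {p} → l ≢ proj₁ p × filter (proj₁ p ≢?_) ls ≡ proj₂ p →
    filter (proj₁ p ≢?_) (l ∷ ls) ≡ l ∷ proj₂ p
  step {l′ , _} (l≢l′ , eq) = trans (filter-accept (l′ ≢?_) (l≢l′ ∘ sym)) (cong (l ∷_) eq)

module _ (m : ℕ) .{{_ : NonZero m}} where

  level-cell : ∀ c l (s : Fin m) → level m (cell c l s) ≡ suc l
  level-cell c l s = cong suc (begin
    (m * l + toℕ s) / m      ≡⟨ +-distrib-/-∣ˡ (toℕ s) (m∣m*n l) ⟩
    m * l / m + toℕ s / m    ≡⟨ cong₂ _+_ (trans (cong (_/ m) (*-comm m l)) (m*n/n≡m l m)) (m<n⇒m/n≡0 (Fin.toℕ<n s)) ⟩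
    l + 0                    ≡⟨ +-identityʳ l ⟩
    l                        ∎)
    where open ≡-Reasoning

  rows : List ℕ → List ℕ
  rows ls = cartesianProductWith (λ l s → m * l + toℕ s) ls (allFin m)

  grid : List ℕ → List ℕ → List Cell
  grid cs ls = cartesianProduct cs (rows ls)

  -- Each level contributes a block of m cells to the column. As the columns differ, the block
  -- survives or disappears as a whole, according to whether its level differs from l.
  filter-column : ∀ {c c′} l (s : Fin m) → c ≢ c′ → ∀ ls →
    filter (nonAttacking? m (cell c l s)) (map (c′ ,_) (rows ls)) ≡ map (c′ ,_) (rows (filter (l ≢?_) ls))
  filter-column l s c≢c′ [] = refl
  filter-column {c} {c′} l s c≢c′ (l′ ∷ ls) = begin
    filter NA (map (c′ ,_) (map (λ s → m * l′ + toℕ s) (allFin m) ++ rows ls))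
      ≡⟨ cong (filter NA) (map-++ (c′ ,_) (map _ (allFin m)) (rows ls)) ⟩
    filter NA (map (c′ ,_) (map (λ s → m * l′ + toℕ s) (allFin m)) ++ map (c′ ,_) (rows ls))
      ≡⟨ filter-++ NA (map (c′ ,_) (map _ (allFin m))) _ ⟩
    filter NA (map (c′ ,_) (map (λ s → m * l′ + toℕ s) (allFin m))) ++ filter NA (map (c′ ,_) (rows ls))
      ≡⟨ cong (filter NA (map (c′ ,_) (map (λ s → m * l′ + toℕ s) (allFin m))) ++_) (filter-column l s c≢c′ ls) ⟩
    filter NA (map (c′ ,_) (map (λ s → m * l′ + toℕ s) (allFin m))) ++ map (c′ ,_) (rows (filter (l ≢?_) ls))
      ≡⟨ by-level ⟩
    map (c′ ,_) (rows (filter (l ≢?_) (l′ ∷ ls))) ∎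
    where
    open ≡-Reasoning
    NA  = nonAttacking? m (cell c l s)
    rest = map (c′ ,_) (rows (filter (l ≢?_) ls))
    by-level : filter NA (map (c′ ,_) (map (λ s → m * l′ + toℕ s) (allFin m))) ++ map (c′ ,_) (rows (filter (l ≢?_) ls))
             ≡ map (c′ ,_) (rows (filter (l ≢?_) (l′ ∷ ls)))
    by-level with l ≟ l′
    ... | yes refl = trans
      (cong (_++ rest) (filter-none NA (All.map⁺ (All.map⁺ (All.universal
        (λ s′ (_ , lev≢) → lev≢ (trans (level-cell c l s) (sym (level-cell c′ l s′)))) (allFin m))))))
      (cong (map (c′ ,_) ∘ rows) (sym (filter-reject (l ≢?_) (λ l≢l → l≢l refl))))
    ... | no l≢l′ = begin
      _ ≡⟨ cong (_++ rest) (filter-all NA (All.map⁺ (All.map⁺ (All.universal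
             (λ s′ → c≢c′ , λ lev≡ → l≢l′ (suc-injective
               (trans (sym (level-cell c l s)) (trans lev≡ (level-cell c′ l′ s′))))) (allFin m))))) ⟩
      map (c′ ,_) (map _ (allFin m)) ++ rest
        ≡⟨ map-++ (c′ ,_) (map _ (allFin m)) _ ⟨
      map (c′ ,_) (rows (l′ ∷ filter (l ≢?_) ls))
        ≡⟨ cong (map (c′ ,_) ∘ rows) (filter-accept (l ≢?_) l≢l′) ⟨
      _ ∎

  filter-grid : ∀ {c cs} l (s : Fin m) ls → All (c ≢_) cs →
    filter (nonAttacking? m (cell c l s)) (grid cs ls) ≡ grid cs (filter (l ≢?_) ls)
  filter-grid l s ls []             = refl
  filter-grid l s ls (c≢c′ ∷ c≢cs) =
    trans (filter-++ (nonAttacking? m _) (map _ (rows ls)) _)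
            (cong₂ _++_ (filter-column l s c≢c′ ls) (filter-grid l s ls c≢cs))

  same-column : ∀ c rs → AllPairs (λ x y → ¬ NonAttacking m x y) (map (c ,_) rs)
  same-column c []       = []
  same-column c (r ∷ rs) = All.map⁺ (All.universal (λ _ (c≢c , _) → c≢c refl) rs) ∷ same-column c rs

  module _ {P : Cell → Set} (P? : Decidable P) where

    -- The clique count obeys the recursion of `rooks`: the cells of the first column attack one
    -- another, so at most one is taken, and what a rook at level l leaves unattacked is the grid on
    -- the other columns and levels.
    cliques-grid : ∀ k {cs ls} → Unique cs → Unique ls →
      cliques (nonAttacking? m) k (filter P? (grid cs ls)) ≡ rookWeight m P? k cs ls
    cliques-grid zero    ucs ule = refl
    cliques-grid (suc k) []  ule = refl
    cliques-grid (suc k) {c ∷ cs} {ls} (c∉cs ∷ ucs) uls = begin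
      count (suc k) (filter P? (map (c ,_) (rows ls) ++ grid cs ls))
        ≡⟨ cong (count (suc k)) (filter-++ P? (map (c ,_) (rows ls)) (grid cs ls)) ⟩
      count (suc k) (filter P? (map (c ,_) (rows ls)) ++ rest)
        ≡⟨ cliques-++ NA? k (filter P? (map (c ,_) (rows ls))) rest (AllPairs.filter⁺ P? (same-column c (rows ls))) ⟩
      ∑ (filter P? (map (c ,_) (rows ls))) (λ x → count k (filter (NA? x) rest)) + count (suc k) rest
        ≡⟨ +-comm _ (count (suc k) rest) ⟩
      count (suc k) rest + ∑ (filter P? (map (c ,_) (rows ls))) (λ x → count k (filter (NA? x) rest))
        ≡⟨ cong₂ _+_ (cliques-grid (suc k) ucs uls) first-column ⟩
      rookWeight m P? (suc k) (c ∷ cs) ls ∎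
      where
      open ≡-Reasoning
      NA? = nonAttacking? m
      count = cliques NA?
      rest = filter P? (grid cs ls)
      δ : ℕ → Fin m → ℕ
      δ l s = 𝟙 (P? (cell c l s))
      level-removed : ∀ {p} → filter (proj₁ p ≢?_) ls ≡ proj₂ p → ∀ (s : Fin m) →
        count k (filter (NA? (cell c (proj₁ p) s)) rest) ≡ rookWeight m P? k cs (proj₂ p)
      level-removed {l , ls′} refl s = begin
        count k (filter (NA? (cell c l s)) (filter P? (grid cs ls)))
          ≡⟨ cong (count k) (filter-comm (NA? (cell c l s)) P? (grid cs ls)) ⟩
        count k (filter P? (filter (NA? (cell c l s)) (grid cs ls)))
          ≡⟨ cong (count k ∘ filter P?) (filter-grid l s ls c∉cs) ⟩
        count k (filter P? (grid cs ls′))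
          ≡⟨ cliques-grid k ucs (Unique.filter⁺ (l ≢?_) uls) ⟩
        rookWeight m P? k cs ls′ ∎
      first-column : ∑ (filter P? (map (c ,_) (rows ls))) (λ x → count k (filter (NA? x) rest)) ≡
                     ∑ (select ls) (λ (l , ls′) → cellsInLevel m P? c l * rookWeight m P? k cs ls′)
      first-column = begin
        ∑ (filter P? (map (c ,_) (rows ls))) (λ x → count k (filter (NA? x) rest))
          ≡⟨ ∑-filter P? (map (c ,_) (rows ls)) _ ⟩
        ∑ (map (c ,_) (rows ls)) (λ x → 𝟙 (P? x) * count k (filter (NA? x) rest))
          ≡⟨ ∑-map (c ,_) (rows ls) _ ⟩
        ∑ (rows ls) (λ r → 𝟙 (P? (c , r)) * count k (filter (NA? (c , r)) rest))
          ≡⟨ ∑-cartesianProductWith _ ls (allFin m) _ ⟩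
        ∑ ls (λ l → ∑ (allFin m) (λ s → δ l s * count k (filter (NA? (cell c l s)) rest)))
          ≡⟨ cong (λ ls′ → ∑ ls′ (λ l → ∑ (allFin m) (λ s →
               δ l s * count k (filter (NA? (cell c l s)) rest)))) (map-proj₁-select ls) ⟨
        ∑ (map proj₁ (select ls)) (λ l → ∑ (allFin m) (λ s → δ l s * count k (filter (NA? (cell c l s)) rest)))
          ≡⟨ ∑-map proj₁ (select ls) _ ⟩
        ∑ (select ls) (λ (l , _) → ∑ (allFin m) (λ s → δ l s * count k (filter (NA? (cell c l s)) rest)))
          -- All m cells of a level leave the same grid behind, so only the number of them
          -- satisfying P matters, which is the weight of that column and level.
          ≡⟨ ∑-cong-All (All.map (λ {(l , ls′)} eq → trans
               (∑-cong (λ s → cong (δ l s *_) (level-removed eq s)) (allFin m))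
               (∑-*ʳ (rookWeight m P? k cs ls′) (allFin m) (δ l))) (select≡filter uls)) ⟩
        ∑ (select ls) (λ (l , ls′) → cellsInLevel m P? c l * rookWeight m P? k cs ls′) ∎

-- R lists both the columns and the levels of the square in this order.
positions : (N : ℕ) → Vec ℕ N
positions N = Vec.tabulate (toℕ ∘ opposite)

toList-tabulate : {A : Set} {n : ℕ} (f : Fin n → A) → toList (Vec.tabulate f) ≡ tabulate f
toList-tabulate {n = zero}  f = refl
toList-tabulate {n = suc n} f = cong (f zero ∷_) (toList-tabulate (f ∘ suc))

opposite-injective : ∀ {n} {i j : Fin n} → opposite i ≡ opposite j → i ≡ j
opposite-injective {i = i} {j} eq =
  trans (sym (Fin.opposite-involutive i)) (trans (cong opposite eq) (Fin.opposite-involutive j))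

positions-unique : ∀ N → Unique (toList (positions N))
positions-unique N = subst Unique (sym (toList-tabulate (toℕ ∘ opposite)))
  (Unique.tabulate⁺ (opposite-injective ∘ Fin.toℕ-injective))

∈-positions : ∀ {N p} → p < N → p ∈ toList (positions N)
∈-positions {N} {p} p<N = subst (_∈ toList (positions N))
  (trans (cong toℕ (Fin.opposite-involutive (fromℕ< p<N))) (Fin.toℕ-fromℕ< p<N))
  (∈-toList⁺ (∈-tabulate⁺ (toℕ ∘ opposite) (opposite (fromℕ< p<N))))

cells-unique : ∀ B → Unique (cells B)
cells-unique B = Unique.concat⁺
  (All.map⁺ (All.universal (λ i → Unique.map⁺ (cong proj₂) (Unique.upTo⁺ (height B i))) (allFin (width B))))
  (AllPairs.map⁺ (AllPairs.map disjoint (Unique.allFin⁺ (width B))))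
  where
  disjoint : ∀ {i j} → i ≢ j → ∀ {x} →
    ¬ (x ∈ map (toℕ (opposite i) ,_) (upTo (height B i)) × x ∈ map (toℕ (opposite j) ,_) (upTo (height B j)))
  disjoint i≢j (x∈i , x∈j) with ∈-map⁻ _ x∈i | ∈-map⁻ _ x∈j
  ... | _ , _ , refl | _ , _ , eq = i≢j (opposite-injective (Fin.toℕ-injective (cong proj₁ eq)))

∈-cells-Sq : ∀ {N m x} → x ∈ cells (Sq N m) → column x < N × row x < m * N
∈-cells-Sq {N} {m} x∈ with satisfied (∈-concatMap⁻ (λ i → map (toℕ (opposite i) ,_) (upTo (m * N))) {xs = allFin N} x∈)
... | i , x∈i with ∈-map⁻ _ x∈i
... | r , r∈ , refl = Fin.toℕ<n (opposite i) , ∈-upTo⁻ r∈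

-- Boards inside the square: rook numbers in matrix form

module _ (m : ℕ) .{{_ : NonZero m}} where

  cell-injective : ∀ {c c′ l l′} {s s′ : Fin m} → cell c l s ≡ cell c′ l′ s′ → c ≡ c′ × l ≡ l′ × s ≡ s′
  cell-injective {c} {c′} {l} {l′} {s} {s′} eq = cong proj₁ eq , l≡l′ ,
    Fin.toℕ-injective (+-cancelˡ-≡ (m * l′) _ _ (trans (cong (λ x → m * x + toℕ s) (sym l≡l′)) (cong proj₂ eq)))
    where
    l≡l′ : l ≡ l′
    l≡l′ = suc-injective (trans (sym (level-cell m c l s)) (trans (cong (level m) eq) (level-cell m c′ l′ s′)))

  grid-unique : ∀ {cs ls} → Unique cs → Unique ls → Unique (grid m cs ls)
  grid-unique ucs uls = Unique.cartesianProduct⁺ ucs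
    (Unique.cartesianProductWith⁺ _ (proj₂ ∘ cell-injective ∘ cong (0 ,_)) uls (Unique.allFin⁺ m))

  ∈-grid : ∀ {N x} → column x < N → row x < m * N → x ∈ grid m (toList (positions N)) (toList (positions N))
  ∈-grid {N} {c , r} c<N r<mN = ∈-cartesianProduct⁺ (∈-positions c<N)
    (subst (_∈ rows m (toList (positions N))) r-split
      (∈-cartesianProductWith⁺ (λ l s → m * l + toℕ s)
        (∈-positions (m<n*o⇒m/o<n {n = N} (subst (r <_) (*-comm m N) r<mN)))
        (∈-allFin (fromℕ< (m%n<n r m)))))
    where
    open ≡-Reasoning
    r-split : m * (r / m) + toℕ (fromℕ< (m%n<n r m)) ≡ r
    r-split = begin
      m * (r / m) + toℕ (fromℕ< (m%n<n r m))  ≡⟨ cong₂ _+_ (*-comm m (r / m)) (Fin.toℕ-fromℕ< (m%n<n r m)) ⟩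
      r / m * m + r % m                       ≡⟨ +-comm (r / m * m) _ ⟩
      r % m + r / m * m                       ≡⟨ m≡m%n+[m/n]*n r m ⟨
      r                                       ∎

  nonAttacking-sym : Symmetric (NonAttacking m)
  nonAttacking-sym (c≢ , l≢) = c≢ ∘ sym , l≢ ∘ sym

  module _ (B : FerrersBoard) (N : ℕ) (fits : B FitsIn Sq N m) where

    private
      ps = positions N
      cs = toList ps

    -- Both lists are free of duplicates and, since the board fits, have the same members; hence
    -- they differ only in order.
    cells↭grid : cells B ↭ filter (_∈? cells B) (grid m cs cs)
    cells↭grid = ∼bag⇒↭ (unique∧set⇒bag (cells-unique B)
      (Unique.filter⁺ (_∈? cells B) (grid-unique (positions-unique N) (positions-unique N)))
      (mk⇔ (λ x∈ → let c< , r< = ∈-cells-Sq {N} {m} (fits x∈) in ∈-filter⁺ (_∈? cells B) (∈-grid c< r<) x∈)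
           (proj₂ ∘ ∈-filter⁻ (_∈? cells B) {xs = grid m cs cs})))

    rookNumber≡rookWeight : ∀ k → rookNumber k m B ≡ rookWeight m (_∈? cells B) k cs cs
    rookNumber≡rookWeight k = begin
      rookNumber k m B
        ≡⟨ length-filter≡∑ (allPairs? (nonAttacking? m)) (choose k (cells B)) ⟩
      cliques (nonAttacking? m) k (cells B)
        ≡⟨ cliques-↭ (nonAttacking? m) nonAttacking-sym k cells↭grid ⟩
      cliques (nonAttacking? m) k (filter (_∈? cells B) (grid m cs cs))
        ≡⟨ cliques-grid m (_∈? cells B) k (positions-unique N) (positions-unique N) ⟩
      rookWeight m (_∈? cells B) k cs cs ∎
      where open ≡-Reasoning

-- Distinctness of the full placements

≐-setoid : Setoid 0ℓ 0ℓ
≐-setoid = record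
  { Carrier       = List Cell
  ; _≈_           = _≐_
  ; isEquivalence = record
    { refl  = id , id
    ; sym   = λ (P⊆Q , Q⊆P) → Q⊆P , P⊆Q
    ; trans = λ (P⊆Q , Q⊆P) (Q⊆S , S⊆Q) → Q⊆S ∘ P⊆Q , Q⊆P ∘ S⊆Q
    }
  }

-- Permutations are compared by their action alone; equality of the records would also involve the
-- inverse functions and the proofs.
≈-setoid : ℕ → Setoid 0ℓ 0ℓ
≈-setoid n = record
  { Carrier       = Permutation′ n
  ; _≈_           = _≈_
  ; isEquivalence = record
    { refl  = λ _ → refl
    ; sym   = λ p i → sym (p i)
    ; trans = λ p q i → trans (p i) (q i)
    }
  }

allPermutations-unique : ∀ n → Uniqueₛ.Unique (≈-setoid n) (allPermutations n)
allPermutations-unique zero    = [] ∷ []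
allPermutations-unique (suc n) =
  Uniqueₛ.cartesianProductWith⁺ (≡.setoid _) (≈-setoid n) (≈-setoid (suc n)) (insert zero)
    insert-injective (Unique.allFin⁺ (suc n)) (allPermutations-unique n)
  where
  insert-injective : ∀ {i j} {ρ τ : Permutation′ n} → insert zero i ρ ≈ insert zero j τ → i ≡ j × ρ ≈ τ
  insert-injective {i} {j} {ρ} {τ} eq = eq zero , λ k → Fin.punchIn-injective i _ _ (begin
    punchIn i (ρ ⟨$⟩ʳ k)           ≡⟨ insert-punchIn zero i ρ k ⟨
    insert zero i ρ ⟨$⟩ʳ suc k     ≡⟨ eq (suc k) ⟩
    insert zero j τ ⟨$⟩ʳ suc k     ≡⟨ insert-punchIn zero j τ k ⟩
    punchIn j (τ ⟨$⟩ʳ k)           ≡⟨ cong (λ l → punchIn l (τ ⟨$⟩ʳ k)) (eq zero) ⟨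
    punchIn i (τ ⟨$⟩ʳ k)           ∎)
    where open ≡-Reasoning

allVecs-unique : {A : Set} {as : List A} → Unique as → ∀ n → Unique (allVecs as n)
allVecs-unique uas zero    = [] ∷ []
allVecs-unique uas (suc n) = Unique.cartesianProductWith⁺ _∷_ Vec.∷-injective uas (allVecs-unique uas n)

deduplicate-unique : {A : Set} {_~_ : A → A → Set} (_~?_ : Decidable₂ _~_) {xs : List A} →
  AllPairs (λ x y → ¬ x ~ y) xs → deduplicate _~?_ xs ≡ xs
deduplicate-unique _~?_ []             = refl
deduplicate-unique _~?_ {x ∷ xs} (x≁xs ∷ xs≁xs) = cong (x ∷_)
  (trans (cong (filter (¬? ∘ (x ~?_))) (deduplicate-unique _~?_ xs≁xs)) (filter-all (¬? ∘ (x ~?_)) x≁xs))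

map-cartesianProductWith : {A B C D : Set} (g : C → D) (f : A → B → C) (xs : List A) (ys : List B) →
  map g (cartesianProductWith f xs ys) ≡ cartesianProductWith (λ x y → g (f x y)) xs ys
map-cartesianProductWith g f []       ys = refl
map-cartesianProductWith g f (x ∷ xs) ys =
  trans (map-++ g (map (f x) ys) _) (cong₂ _++_ (sym (map-∘ ys)) (map-cartesianProductWith g f xs ys))

-- Hit numbers as the distribution of the number of hits

module _ (m : ℕ) .{{_ : NonZero m}} (N : ℕ) where

  -- Each placement has just one rook in column i. Equal placements therefore share that rook; its
  -- level determines the value of the permutation at i, and its height within the level determines
  -- the exponent.
  R-injective : {v w : Vec (Fin m) N} {σ τ : Permutation′ N} → R (v ⨾ σ) ≐ R (w ⨾ τ) → v ≡ w × σ ≈ τ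
  R-injective {v} {w} {σ} {τ} (R⊆R′ , _) = v≡w , λ i → proj₁ (pointwise i)
    where
    pointwise : ∀ i → σ ⟨$⟩ʳ i ≡ τ ⟨$⟩ʳ i × lookup v i ≡ lookup w i
    pointwise i with ∈-map⁻ _ (R⊆R′ (∈-map⁺ _ (∈-allFin i)))
    ... | j , _ , eq with cell-injective m eq
    ... | c≡ , l≡ , s≡ with refl ← opposite-injective {i = i} {j} (Fin.toℕ-injective c≡) =
      opposite-injective (Fin.toℕ-injective l≡) , s≡
    v≡w : v ≡ w
    v≡w = trans (sym (Vec.tabulate∘lookup v)) (trans (Vec.tabulate-cong (proj₂ ∘ pointwise)) (Vec.tabulate∘lookup w))

  placements-unique : Uniqueₛ.Unique ≐-setoid (map R (wreathElements m N))
  placements-unique = subst (Uniqueₛ.Unique ≐-setoid)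
    (sym (map-cartesianProductWith R _⨾_ (allVecs (allFin m) N) (allPermutations N)))
    (Uniqueₛ.cartesianProductWith⁺ (≡.setoid _) (≈-setoid N) ≐-setoid (λ v σ → R (v ⨾ σ))
      (λ {v} {w} {σ} {τ} → R-injective {v} {w} {σ} {τ})
      (allVecs-unique (Unique.allFin⁺ m) N) (allPermutations-unique N))

  hitCounts : FerrersBoard → List ℕ
  hitCounts B = map (λ ω → # R ω ∩ B) (wreathElements m N)

  -- Distinct group elements give distinct placements, so deduplication removes nothing and the hit
  -- set can be counted over the group.
  hitNumber≡countEq : ∀ k B → hitNumber k N m B ≡ countEq k (hitCounts B)
  hitNumber≡countEq k B = begin
    hitNumber k N m B
      ≡⟨ cong length (deduplicate-unique _≐?_ (AllPairs.filter⁺ _ placements-unique)) ⟩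
    length (filter (λ P → (# P ∩ B) ≟ k) (map R (wreathElements m N)))
      ≡⟨ length-filter≡∑ (λ P → (# P ∩ B) ≟ k) (map R (wreathElements m N)) ⟩
    ∑ (map R (wreathElements m N)) (λ P → 𝟙 ((# P ∩ B) ≟ k))
      ≡⟨ ∑-map R (wreathElements m N) _ ⟩
    ∑ (wreathElements m N) (λ ω → 𝟙 ((# R ω ∩ B) ≟ k))
      ≡⟨ ∑-map (λ ω → # R ω ∩ B) (wreathElements m N) _ ⟨
    countEq k (hitCounts B) ∎
    where open ≡-Reasoning

  #R∩≡hits : ∀ B (v : Vec (Fin m) N) (σ : Permutation′ N) →
    # R (v ⨾ σ) ∩ B ≡ hits m (_∈? cells B) (positions N) (positions N) v σ
  #R∩≡hits B v σ = begin
    # R (v ⨾ σ) ∩ B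
      ≡⟨ length-filter≡∑ (_∈? cells B) (R (v ⨾ σ)) ⟩
    ∑ (R (v ⨾ σ)) (λ x → 𝟙 (x ∈? cells B))
      ≡⟨ ∑-map _ (allFin N) _ ⟩
    ∑ (allFin N) (λ i → 𝟙 (cell (toℕ (opposite i)) (toℕ (opposite (σ ⟨$⟩ʳ i))) (lookup v i) ∈? cells B))
      ≡⟨ ∑-cong (λ i → cong₂ (λ c l → 𝟙 (cell c l (lookup v i) ∈? cells B))
           (Vec.lookup∘tabulate (toℕ ∘ opposite) i) (Vec.lookup∘tabulate (toℕ ∘ opposite) (σ ⟨$⟩ʳ i))) (allFin N) ⟨
    hits m (_∈? cells B) (positions N) (positions N) v σ ∎
    where open ≡-Reasoning

  moment-hitCounts : ∀ B → B FitsIn Sq N m → ∀ j →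
    moment j (hitCounts B) ≡ completions m (N ∸ j) * rookNumber j m B
  moment-hitCounts B fits j = begin
    moment j (hitCounts B)
      ≡⟨ ∑-map (λ ω → # R ω ∩ B) (wreathElements m N) _ ⟩
    ∑ (wreathElements m N) (λ ω → (# R ω ∩ B) C j)
      ≡⟨ ∑-cartesianProductWith _⨾_ (allVecs (allFin m) N) (allPermutations N) _ ⟩
    ∑ (allVecs (allFin m) N) (λ v → ∑ (allPermutations N) (λ σ → (# R (v ⨾ σ) ∩ B) C j))
      ≡⟨ ∑-cong (λ v → ∑-cong (λ σ → cong (_C j) (#R∩≡hits B v σ)) (allPermutations N)) (allVecs (allFin m) N) ⟩
    ∑-hits m (_∈? cells B) (_C j) (positions N) (positions N)
      ≡⟨ ∑-hits-C m (_∈? cells B) j (positions N) (positions N) ⟩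
    completions m (N ∸ j) * rookWeight m (_∈? cells B) j (toList (positions N)) (toList (positions N))
      ≡⟨ cong (completions m (N ∸ j) *_) (rookNumber≡rookWeight m B N fits j) ⟨
    completions m (N ∸ j) * rookNumber j m B ∎
    where open ≡-Reasoning

corollary25 : (m : ℕ) .{{_ : NonZero m}} (B B′ : FerrersBoard) → RookEquivalent m B B′ → (N : ℕ) → B FitsIn Sq N m → B′ FitsIn Sq N m → (k : ℕ) → k ≤ N → hitNumber k N m B ≡ hitNumber k N m B′
corollary25 m B B′ B~B′ N fits fits′ k _ = begin
  hitNumber k N m B            ≡⟨ hitNumber≡countEq m N k B ⟩
  countEq k (hitCounts m N B)  ≡⟨ moments⇒countEq (hitCounts m N B) (hitCounts m N B′) same-moments k ⟩
  countEq k (hitCounts m N B′) ≡⟨ hitNumber≡countEq m N k B′ ⟨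
  hitNumber k N m B′           ∎
  where
  open ≡-Reasoning
  same-moments : ∀ j → moment j (hitCounts m N B) ≡ moment j (hitCounts m N B′)
  same-moments j = begin
    moment j (hitCounts m N B)                 ≡⟨ moment-hitCounts m N B fits j ⟩
    completions m (N ∸ j) * rookNumber j m B   ≡⟨ cong (completions m (N ∸ j) *_) (B~B′ j) ⟩
    completions m (N ∸ j) * rookNumber j m B′  ≡⟨ moment-hitCounts m N B′ fits′ j ⟨
    moment j (hitCounts m N B′)                ∎
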